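{- There exist a strongly equitably 2-chromatic $P_4$ system $(V,\mathcal B)$ of order 28 and two distinct vertices $x,y\in V$ such that $x$ and $y$ receive different colours in every 2-colouring of $(V,\mathcal B)$.
   Context: $P_4=(a_1,a_2,a_3,a_4)$ denotes the path on four distinct vertices with edges $\{a_1,a_2\},\{a_2,a_3\},\{a_3,a_4\}$. A $P_4$ system of order $n>1$ is a pair $(V,\mathcal B)$ where $|V|=n$ and $\mathcal B$ is a set of $P_4$ paths with vertices in $V$ whose edge sets partition the edge set of the complete graph on $V$. A $k$-colouring of $(V,\mathcal B)$ is an assignment of one of $k$ colours to each vertex of $V$ such that no path in $\mathcal B$ is monochromatic. The system is $k$-colourable if it has a $k$-colouring, and $k$-chromatic if it is $k$-colourable but not $(k-1)$-colourable. A colouring is strongly equitable if all colour classes have the same size. The system is strongly equitably $k$-chromatic if it is $k$-chromatic and admits a strongly equitable $k$-colouring. -}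

module Defs where

open import Data.Fin using (Fin; _≟_)
open import Data.List using (List; []; _∷_; length; lookup; filter; allFin)
open import Data.List.Relation.Unary.All using (All)
open import Data.List.Relation.Unary.Any using (Any)
open import Data.List.Relation.Unary.Unique.Propositional using (Unique)
open import Data.Nat using (ℕ; pred; _<_)
open import Data.Product using (Σ; ∃!; _×_; _,_)
open import Data.Sum using (_⊎_)
open import Relation.Binary.PropositionalEquality using (_≡_; _≢_)
open import Relation.Nullary using (¬_)

record P₄ (V : Set) : Set where
  constructor path
  field
    a₁ a₂ a₃ a₄ : V
    distinct    : Unique (a₁ ∷ a₂ ∷ a₃ ∷ a₄ ∷ [])

  edges : List (V × V)
  edges = (a₁ , a₂) ∷ (a₂ , a₃) ∷ (a₃ , a₄) ∷ []

-- Pairs stand for undirected edges, so they are compared up to swapping.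
SameEdge : {V : Set} → V × V → V × V → Set
SameEdge (u , v) (x , y) = (u ≡ x × v ≡ y) ⊎ (u ≡ y × v ≡ x)

_∈E_ : {V : Set} → V × V → P₄ V → Set
e ∈E p = Any (SameEdge e) (P₄.edges p)

-- The vertex set of a system of order n is Fin n.  The set of paths is given
-- by a list.  Uniqueness in `partition` is uniqueness of the position in that
-- list, so it also rules out repeating a path, either literally or reversed.
record P₄System (n : ℕ) : Set where
  field
    order>1   : 1 < n
    blocks    : List (P₄ (Fin n))
    partition : ∀ (u v : Fin n) → u ≢ v →
                ∃! _≡_ (λ (i : Fin (length blocks)) → (u , v) ∈E lookup blocks i)

Monochromatic : {V C : Set} → (V → C) → P₄ V → Set
Monochromatic c p = c a₁ ≡ c a₂ × c a₂ ≡ c a₃ × c a₃ ≡ c a₄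
  where open P₄ p

record Colouring {n : ℕ} (S : P₄System n) (k : ℕ) : Set where
  field
    colour : Fin n → Fin k
    proper : All (λ p → ¬ Monochromatic colour p) (P₄System.blocks S)

open Colouring public using (colour)

Chromatic : {n : ℕ} → P₄System n → ℕ → Set
Chromatic S k = Colouring S k × ¬ Colouring S (pred k)

classSize : {n k : ℕ} → (Fin n → Fin k) → Fin k → ℕ
classSize {n} c i = length (filter (λ v → c v ≟ i) (allFin n))

StronglyEquitable : {n k : ℕ} {S : P₄System n} → Colouring S k → Set
StronglyEquitable {k = k} c =
  ∀ (i j : Fin k) → classSize (colour c) i ≡ classSize (colour c) j

StronglyEquitablyChromatic : {n : ℕ} → P₄System n → ℕ → Set
StronglyEquitablyChromatic S k =
  Chromatic S k × Σ (Colouring S k) StronglyEquitable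

{-# OPTIONS --safe #-}
-- A P₄ system can be altered by exchanging a few paths for others on the same
-- edges.  Local search with such exchanges, which kept the colouring by parity
-- proper and shrank the search tree refuting all 2-colourings that agree on the
-- vertices 0 and 1, led to the 126 paths used here; the tree has 17 leaves.
module Submission where

open import Defs
open import Data.Fin using (Fin; zero; suc; toℕ; #_)
open import Data.Fin.Properties using (all?; toℕ-injective)
open import Data.List using (List; []; _∷_; filter; lookup)
import Data.List.Membership.DecPropositional as DecMembership
open import Data.List.Membership.Propositional using (_∈_)
open import Data.List.Membership.Propositional.Properties using (∈-lookup)
open import Data.List.Relation.Unary.All as All using (All; []; _∷_)
open import Data.List.Relation.Unary.AllPairs as AllPairs using (AllPairs; allPairs?; _∷_)
open import Data.List.Relation.Unary.Any as Any using (Any; any?)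
open import Data.List.Relation.Unary.Any.Properties using (filter⁻; lookup-index)
open import Data.List.Relation.Unary.Unique.Propositional using (Unique)
import Data.List.Relation.Unary.Unique.DecPropositional as DecUnique
open import Data.Nat as ℕ using (ℕ; s≤s; z≤n)
open import Data.Nat.DivMod using (_mod_)
open import Data.Product using (Σ-syntax; ∃!; _×_; _,_)
open import Data.Sum using (inj₁; inj₂)
open import Relation.Binary.PropositionalEquality using (_≡_; _≢_; refl; sym; trans; cong)
open import Relation.Nullary using (¬_; Dec; yes; no; contradiction)
open import Relation.Nullary.Decidable using (True; map′; toWitness; ¬?; _×-dec_; _⊎-dec_; _→-dec_)

-- Comparing numerals is much faster than the structural Data.Fin._≟_ in the
-- exhaustive checks below.
_≟_ : ∀ {n} (i j : Fin n) → Dec (i ≡ j)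
i ≟ j = map′ toℕ-injective (cong toℕ) (toℕ i ℕ.≟ toℕ j)

_∈?_ : ∀ {n} (i : Fin n) (is : List (Fin n)) → Dec (i ∈ is)
_∈?_ = DecMembership._∈?_ _≟_

unique? : ∀ {n} (is : List (Fin n)) → Dec (Unique is)
unique? = DecUnique.unique? _≟_

SameEdge? : ∀ {n} (e f : Fin n × Fin n) → Dec (SameEdge e f)
SameEdge? (u , v) (x , y) = (u ≟ x ×-dec v ≟ y) ⊎-dec (u ≟ y ×-dec v ≟ x)

_∈E?_ : ∀ {n} (e : Fin n × Fin n) (p : P₄ (Fin n)) → Dec (e ∈E p)
e ∈E? p = any? (SameEdge? e) (P₄.edges p)

SameEdge-euclidean : {V : Set} {e f g : V × V} → SameEdge e f → SameEdge e g → SameEdge f g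
SameEdge-euclidean (inj₁ (refl , refl)) s                    = s
SameEdge-euclidean (inj₂ (refl , refl)) (inj₁ (refl , refl)) = inj₂ (refl , refl)
SameEdge-euclidean (inj₂ (refl , refl)) (inj₂ (refl , refl)) = inj₁ (refl , refl)

-- Quantifying over the listed edges of `p` alone leaves a finite check; `edgeDisjoint⇒∉E` extends
-- it to either orientation.
EdgeDisjoint : {V : Set} → P₄ V → P₄ V → Set
EdgeDisjoint p q = All (λ e → ¬ e ∈E q) (P₄.edges p)

edgeDisjoint? : ∀ {n} (p q : P₄ (Fin n)) → Dec (EdgeDisjoint p q)
edgeDisjoint? p q = All.all? (λ e → ¬? (e ∈E? q)) (P₄.edges p)

-- Up to orientation, an edge `e` of `p` is a listed edge `f` of `p`; if `e` lay in `q`, so would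
-- `f`.
edgeDisjoint⇒∉E : {V : Set} {e : V × V} (p q : P₄ V) →
                  EdgeDisjoint p q → e ∈E p → ¬ e ∈E q
edgeDisjoint⇒∉E p q disjoint e∈p e∈q with f∉q , e≈f ← All.lookupAny disjoint e∈p =
  f∉q (Any.map (SameEdge-euclidean e≈f) e∈q)

-- `AllPairs` compares an entry only with later ones. Of two distinct positions, the earlier one
-- therefore supplies the exclusion, in whichever order they are given.
allPairs-exclusive⇒index-unique :
  {A : Set} {P : A → Set} {xs : List A} → AllPairs (λ x y → P x → ¬ P y) xs →
  ∀ i j → P (lookup xs i) → P (lookup xs j) → i ≡ j
allPairs-exclusive⇒index-unique (_ ∷ _) zero zero _ _ = refl
allPairs-exclusive⇒index-unique (x# ∷ _) zero (suc j) px py =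
  contradiction py (All.lookup x# (∈-lookup j) px)
allPairs-exclusive⇒index-unique (x# ∷ _) (suc i) zero px py =
  contradiction px (All.lookup x# (∈-lookup i) py)
allPairs-exclusive⇒index-unique (_ ∷ xs#) (suc i) (suc j) px py =
  cong suc (allPairs-exclusive⇒index-unique xs# i j px py)

edge-in-unique-path : {V : Set} {ps : List (P₄ V)} {e : V × V} →
                      AllPairs EdgeDisjoint ps → Any (e ∈E_) ps →
                      ∃! _≡_ (λ i → e ∈E lookup ps i)
edge-in-unique-path {e = e} disjoint e∈ps =
  Any.index e∈ps , lookup-index e∈ps ,
  allPairs-exclusive⇒index-unique {P = e ∈E_}
    (AllPairs.map (λ {p} {q} → edgeDisjoint⇒∉E p q) disjoint) _ _ (lookup-index e∈ps)

vertices : {V : Set} → P₄ V → List V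
vertices p = a₁ ∷ a₂ ∷ a₃ ∷ a₄ ∷ []
  where open P₄ p

fin : ℕ → Fin 28
fin m = m mod 28

⟨_,_,_,_⟩ : (a b c d : ℕ) {_ : True (unique? (fin a ∷ fin b ∷ fin c ∷ fin d ∷ []))} → P₄ (Fin 28)
⟨ a , b , c , d ⟩ {distinct} = path (fin a) (fin b) (fin c) (fin d) (toWitness distinct)

-- The first 16 paths, at positions 0 to 15, are those named at the leaves of `refutation`. The
-- others complete the partition: 126 paths of 3 edges make up the 378 edges on 28 vertices.
paths : List (P₄ (Fin 28))
paths =
  ⟨ 0 , 2 , 1 , 11 ⟩ ∷ ⟨ 1 , 0 , 24 , 11 ⟩ ∷ ⟨ 0 , 11 , 17 , 1 ⟩ ∷
  ⟨ 11 , 3 , 1 , 16 ⟩ ∷ ⟨ 17 , 2 , 16 , 24 ⟩ ∷ ⟨ 2 , 3 , 17 , 24 ⟩ ∷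
  ⟨ 0 , 8 , 14 , 1 ⟩ ∷ ⟨ 0 , 16 , 8 , 1 ⟩ ∷ ⟨ 0 , 15 , 1 , 21 ⟩ ∷
  ⟨ 11 , 15 , 14 , 16 ⟩ ∷ ⟨ 16 , 11 , 14 , 21 ⟩ ∷ ⟨ 1 , 22 , 0 , 13 ⟩ ∷
  ⟨ 0 , 27 , 13 , 1 ⟩ ∷ ⟨ 8 , 11 , 27 , 22 ⟩ ∷ ⟨ 8 , 15 , 13 , 11 ⟩ ∷
  ⟨ 11 , 21 , 8 , 13 ⟩ ∷ ⟨ 0 , 4 , 10 , 3 ⟩ ∷ ⟨ 0 , 5 , 24 , 14 ⟩ ∷
  ⟨ 0 , 6 , 2 , 15 ⟩ ∷ ⟨ 0 , 9 , 27 , 24 ⟩ ∷ ⟨ 0 , 17 , 27 , 7 ⟩ ∷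
  ⟨ 0 , 20 , 24 , 15 ⟩ ∷ ⟨ 0 , 26 , 3 , 5 ⟩ ∷ ⟨ 1 , 5 , 27 , 18 ⟩ ∷
  ⟨ 1 , 6 , 4 , 5 ⟩ ∷ ⟨ 1 , 7 , 10 , 27 ⟩ ∷ ⟨ 1 , 10 , 17 , 19 ⟩ ∷
  ⟨ 1 , 18 , 21 , 17 ⟩ ∷ ⟨ 2 , 5 , 20 , 22 ⟩ ∷ ⟨ 2 , 9 , 20 , 23 ⟩ ∷
  ⟨ 2 , 14 , 17 , 23 ⟩ ∷ ⟨ 2 , 19 , 0 , 21 ⟩ ∷ ⟨ 2 , 21 , 6 , 14 ⟩ ∷
  ⟨ 2 , 22 , 9 , 13 ⟩ ∷ ⟨ 3 , 0 , 23 , 18 ⟩ ∷ ⟨ 3 , 9 , 7 , 20 ⟩ ∷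
  ⟨ 3 , 15 , 22 , 6 ⟩ ∷ ⟨ 3 , 22 , 16 , 13 ⟩ ∷ ⟨ 3 , 24 , 2 , 12 ⟩ ∷
  ⟨ 3 , 27 , 14 , 12 ⟩ ∷ ⟨ 4 , 8 , 19 , 23 ⟩ ∷ ⟨ 4 , 14 , 5 , 11 ⟩ ∷
  ⟨ 4 , 25 , 12 , 11 ⟩ ∷ ⟨ 5 , 7 , 23 , 24 ⟩ ∷ ⟨ 5 , 9 , 8 , 18 ⟩ ∷
  ⟨ 5 , 12 , 1 , 9 ⟩ ∷ ⟨ 5 , 15 , 16 , 18 ⟩ ∷ ⟨ 5 , 16 , 10 , 21 ⟩ ∷
  ⟨ 5 , 18 , 0 , 14 ⟩ ∷ ⟨ 5 , 19 , 3 , 6 ⟩ ∷ ⟨ 5 , 22 , 12 , 23 ⟩ ∷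
  ⟨ 5 , 26 , 18 , 22 ⟩ ∷ ⟨ 6 , 5 , 10 , 22 ⟩ ∷ ⟨ 6 , 7 , 13 , 12 ⟩ ∷
  ⟨ 6 , 10 , 25 , 23 ⟩ ∷ ⟨ 6 , 15 , 26 , 22 ⟩ ∷ ⟨ 6 , 23 , 13 , 17 ⟩ ∷
  ⟨ 6 , 25 , 7 , 12 ⟩ ∷ ⟨ 6 , 27 , 26 , 25 ⟩ ∷ ⟨ 7 , 18 , 2 , 25 ⟩ ∷
  ⟨ 7 , 19 , 9 , 18 ⟩ ∷ ⟨ 8 , 3 , 14 , 10 ⟩ ∷ ⟨ 8 , 7 , 17 , 22 ⟩ ∷
  ⟨ 8 , 10 , 19 , 12 ⟩ ∷ ⟨ 8 , 12 , 9 , 16 ⟩ ∷ ⟨ 8 , 20 , 11 , 26 ⟩ ∷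
  ⟨ 9 , 4 , 20 , 26 ⟩ ∷ ⟨ 9 , 10 , 2 , 26 ⟩ ∷ ⟨ 9 , 11 , 4 , 23 ⟩ ∷
  ⟨ 9 , 14 , 20 , 10 ⟩ ∷ ⟨ 9 , 17 , 8 , 23 ⟩ ∷ ⟨ 9 , 23 , 14 , 25 ⟩ ∷
  ⟨ 9 , 24 , 10 , 23 ⟩ ∷ ⟨ 9 , 25 , 20 , 13 ⟩ ∷ ⟨ 10 , 0 , 7 , 15 ⟩ ∷
  ⟨ 10 , 12 , 6 , 13 ⟩ ∷ ⟨ 10 , 26 , 7 , 16 ⟩ ∷ ⟨ 11 , 2 , 4 , 12 ⟩ ∷
  ⟨ 11 , 6 , 8 , 27 ⟩ ∷ ⟨ 11 , 7 , 2 , 20 ⟩ ∷ ⟨ 11 , 18 , 17 , 15 ⟩ ∷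
  ⟨ 11 , 23 , 3 , 16 ⟩ ∷ ⟨ 12 , 3 , 20 , 16 ⟩ ∷ ⟨ 12 , 17 , 5 , 21 ⟩ ∷
  ⟨ 12 , 20 , 17 , 26 ⟩ ∷ ⟨ 12 , 21 , 25 , 15 ⟩ ∷ ⟨ 12 , 26 , 16 , 19 ⟩ ∷
  ⟨ 13 , 2 , 8 , 25 ⟩ ∷ ⟨ 13 , 4 , 26 , 19 ⟩ ∷ ⟨ 13 , 14 , 22 , 19 ⟩ ∷
  ⟨ 13 , 19 , 6 , 18 ⟩ ∷ ⟨ 13 , 26 , 9 , 15 ⟩ ∷ ⟨ 14 , 7 , 4 , 22 ⟩ ∷
  ⟨ 14 , 18 , 12 , 27 ⟩ ∷ ⟨ 14 , 19 , 21 , 27 ⟩ ∷ ⟨ 14 , 26 , 6 , 17 ⟩ ∷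
  ⟨ 15 , 10 , 13 , 18 ⟩ ∷ ⟨ 15 , 12 , 0 , 25 ⟩ ∷ ⟨ 15 , 19 , 4 , 17 ⟩ ∷
  ⟨ 15 , 21 , 26 , 24 ⟩ ∷ ⟨ 15 , 27 , 19 , 20 ⟩ ∷ ⟨ 16 , 4 , 15 , 20 ⟩ ∷
  ⟨ 16 , 6 , 24 , 19 ⟩ ∷ ⟨ 16 , 12 , 24 , 21 ⟩ ∷ ⟨ 16 , 21 , 22 , 24 ⟩ ∷
  ⟨ 16 , 23 , 15 , 18 ⟩ ∷ ⟨ 16 , 25 , 11 , 19 ⟩ ∷ ⟨ 17 , 16 , 27 , 23 ⟩ ∷
  ⟨ 17 , 25 , 24 , 18 ⟩ ∷ ⟨ 18 , 3 , 13 , 21 ⟩ ∷ ⟨ 18 , 10 , 11 , 22 ⟩ ∷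
  ⟨ 18 , 19 , 1 , 26 ⟩ ∷ ⟨ 18 , 20 , 1 , 25 ⟩ ∷ ⟨ 19 , 25 , 13 , 22 ⟩ ∷
  ⟨ 20 , 6 , 9 , 21 ⟩ ∷ ⟨ 20 , 21 , 7 , 24 ⟩ ∷ ⟨ 20 , 27 , 25 , 22 ⟩ ∷
  ⟨ 21 , 3 , 4 , 27 ⟩ ∷ ⟨ 21 , 4 , 1 , 24 ⟩ ∷ ⟨ 21 , 23 , 2 , 27 ⟩ ∷
  ⟨ 22 , 7 , 3 , 25 ⟩ ∷ ⟨ 23 , 5 , 8 , 24 ⟩ ∷ ⟨ 23 , 22 , 8 , 26 ⟩ ∷
  ⟨ 24 , 4 , 18 , 25 ⟩ ∷ ⟨ 24 , 13 , 5 , 25 ⟩ ∷ ⟨ 26 , 23 , 1 , 27 ⟩ ∷ []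

paths-edgeDisjoint : AllPairs EdgeDisjoint paths
paths-edgeDisjoint = toWitness {a? = allPairs? edgeDisjoint? paths} _

Joined : Fin 28 → List (P₄ (Fin 28)) → Set
Joined u ps = ∀ v → u ≢ v → Any ((u , v) ∈E_) ps

joined? : ∀ u ps → Dec (Joined u ps)
joined? u ps = all? λ v → ¬? (u ≟ v) →-dec any? ((u , v) ∈E?_) ps

-- Searching only these paths keeps the check that every edge is covered fast.
through : Fin 28 → List (P₄ (Fin 28))
through u = filter (λ p → u ∈? vertices p) paths

paths-cover : ∀ u → Joined u paths
paths-cover u v u≢v =
  -- Coverage is evaluated inside `through w` for each `w`; an occurrence there is one in `paths`.
  filter⁻ (λ p → u ∈? vertices p)
    (toWitness {a? = all? λ w → joined? w (through w)} _ u v u≢v)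

system : P₄System 28
system = record
  { order>1   = s≤s (s≤s z≤n)
  ; blocks    = paths
  ; partition = λ u v u≢v → edge-in-unique-path paths-edgeDisjoint (paths-cover u v u≢v)
  }

monochromatic? : ∀ {n k} (c : Fin n → Fin k) (p : P₄ (Fin n)) → Dec (Monochromatic c p)
monochromatic? c p = c a₁ ≟ c a₂ ×-dec c a₂ ≟ c a₃ ×-dec c a₃ ≟ c a₄
  where open P₄ p

parity : Fin 28 → Fin 2
parity v = toℕ v mod 2

parityColouring : Colouring system 2
parityColouring = record
  { colour = parity
  ; proper = toWitness {a? = All.all? (λ p → ¬? (monochromatic? parity p)) paths} _
  }

-- Fourteen of the numbers below 28 are even and fourteen odd, so both sizes evaluate to 14.
parityColouring-stronglyEquitable : StronglyEquitable parityColouring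
parityColouring-stronglyEquitable zero       zero       = refl
parityColouring-stronglyEquitable zero       (suc zero) = refl
parityColouring-stronglyEquitable (suc zero) zero       = refl
parityColouring-stronglyEquitable (suc zero) (suc zero) = refl

Fin1-irrelevant : (i j : Fin 1) → i ≡ j
Fin1-irrelevant zero zero = refl

-- With a single colour every path is monochromatic; the first one already contradicts properness.
¬1-colourable : ¬ Colouring system 1
¬1-colourable c = All.head (Colouring.proper c)
  (Fin1-irrelevant _ _ , Fin1-irrelevant _ _ , Fin1-irrelevant _ _)

constant⇒monochromatic : {V C : Set} {c : V → C} {k : C} (p : P₄ V) →
                         All (λ v → c v ≡ k) (vertices p) → Monochromatic c p
constant⇒monochromatic p (e₁ ∷ e₂ ∷ e₃ ∷ e₄ ∷ []) =
  trans e₁ (sym e₂) , trans e₂ (sym e₃) , trans e₃ (sym e₄)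

-- Refutes the 2-colourings that give one colour to all of S and the other to
-- all of D; a clash names a path inside S or inside D.
data Refutation {n} (ps : List (P₄ (Fin n))) (S D : List (Fin n)) : Set where
  clashˢ : ∀ i {_ : True (All.all? (_∈? S) (vertices (lookup ps i)))} → Refutation ps S D
  clashᵈ : ∀ i {_ : True (All.all? (_∈? D) (vertices (lookup ps i)))} → Refutation ps S D
  branch : ∀ v → Refutation ps (v ∷ S) D → Refutation ps S (v ∷ D) → Refutation ps S D

other : Fin 2 → Fin 2
other zero       = suc zero
other (suc zero) = zero

-- Makes branching exhaustive: a vertex without the colour of `S` has the colour of `D`.
≢⇒≡other : ∀ {i j : Fin 2} → i ≢ j → i ≡ other j
≢⇒≡other {zero}     {zero}     i≢j = contradiction refl i≢j
≢⇒≡other {zero}     {suc zero} _   = refl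
≢⇒≡other {suc zero} {zero}     _   = refl
≢⇒≡other {suc zero} {suc zero} i≢j = contradiction refl i≢j

path-not-constant : ∀ {n k} {sys : P₄System n} (c : Colouring sys k) {a : Fin k} {W : List (Fin n)} →
                    All (λ v → colour c v ≡ a) W →
                    ∀ i → ¬ All (_∈ W) (vertices (lookup (P₄System.blocks sys) i))
path-not-constant {sys = sys} c constant i vs⊆W =
  All.lookup (Colouring.proper c) (∈-lookup i)
    (constant⇒monochromatic (lookup (P₄System.blocks sys) i) (All.map (All.lookup constant) vs⊆W))

-- Induction on the tree: a branch follows the actual colour of `v`, and a leaf yields a
-- monochromatic path. Since `a` is arbitrary, one tree serves both possible common colours.
refute : ∀ {n} {sys : P₄System n} (c : Colouring sys 2) {a : Fin 2} {S D : List (Fin n)} →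
         Refutation (P₄System.blocks sys) S D →
         All (λ v → colour c v ≡ a) S → ¬ All (λ v → colour c v ≡ other a) D
refute c (clashˢ i {vs⊆S}) s d = path-not-constant c s i (toWitness vs⊆S)
refute c (clashᵈ i {vs⊆D}) s d = path-not-constant c d i (toWitness vs⊆D)
refute c {a} (branch v same differ) s d with colour c v ≟ a
... | yes cv≡a = refute c same (cv≡a ∷ s) d
... | no  cv≢a = refute c differ s (≢⇒≡other cv≢a ∷ d)

-- A `branch` whose first subtree is a `clashˢ` is a forced move: its vertex would complete a path
-- inside `S`, so it joins `D`. The other branches are genuine case distinctions.
refutation : Refutation paths (# 1 ∷ # 0 ∷ []) []
refutation =
  branch (# 11)
  -- With 11 in `S`, the vertices 2, 24 and 17 are forced into `D`; either choice for 3 then fails.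
  (branch (# 2) (clashˢ (# 0))
   (branch (# 24) (clashˢ (# 1))
    (branch (# 17) (clashˢ (# 2))
     (branch (# 3)
      (branch (# 16) (clashˢ (# 3))
       (clashᵈ (# 4)))
      (clashᵈ (# 5))))))
  -- Now 11 is in `D`. If 8 is in `S`, then 14 and 16 are forced into `D`, and 21 fails either way.
  (branch (# 8)
   (branch (# 14) (clashˢ (# 6))
    (branch (# 16) (clashˢ (# 7))
     (branch (# 21)
      (branch (# 15) (clashˢ (# 8))
       (clashᵈ (# 9)))
      (clashᵈ (# 10)))))
   -- Here 8 and 11 are both in `D`.
   (branch (# 13)
    (branch (# 22) (clashˢ (# 11))
     (branch (# 27) (clashˢ (# 12))
      (clashᵈ (# 13))))
    (branch (# 21)
     (branch (# 15) (clashˢ (# 8))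
      (clashᵈ (# 14)))
     (clashᵈ (# 15)))))

lemma4p1 : Σ[ S ∈ P₄System 28 ] (StronglyEquitablyChromatic S 2 ×
    Σ[ x ∈ Fin 28 ] Σ[ y ∈ Fin 28 ] (x ≢ y ×
    ((c : Colouring S 2) → colour c x ≢ colour c y)))
lemma4p1 =
  system ,
  ((parityColouring , ¬1-colourable) , parityColouring , parityColouring-stronglyEquitable) ,
  -- The `refl` fixes `a` as the colour of vertex 0; `D` starts empty.
  # 0 , # 1 , (λ ()) , λ c c0≡c1 → refute c refutation (sym c0≡c1 ∷ refl ∷ []) []
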